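{- Let $G^\sigma$ be an oriented graph of order $n$ having a pendant vertex. Then $sr(G^\sigma)=4$ if and only if $G^\sigma$ is one of the following: (1) a graph obtained from an oriented star $S^\sigma_{n-n_1-n_2}$ and a complete bipartite oriented graph $K^\sigma_{n_1,n_2}$ with $n_1+n_2\geq 2$, in which every cycle of length $4$ is evenly-oriented, by inserting edges, with arbitrary orientations, between the center of the star and some (possibly all) vertices of $K^\sigma_{n_1,n_2}$; (2) a graph obtained from an oriented star $S^\sigma_{n-n_1-n_2-n_3}$ and a complete tripartite oriented graph $K^\sigma_{n_1,n_2,n_3}$ with $n_1+n_2+n_3\geq 3$, in which every cycle of length $4$ is evenly-oriented, by inserting edges, with arbitrary orientations, between the center of the star and some (possibly all) vertices of $K^\sigma_{n_1,n_2,n_3}$.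
   Context: An oriented graph $G^\sigma$ is a simple graph $G$ (underlying graph) together with an orientation of each edge. Its skew-adjacency matrix $S(G^\sigma)=(s_{ij})$ has $s_{ij}=1$ if there is an arc from $v_i$ to $v_j$, $s_{ij}=-1$ if there is an arc from $v_j$ to $v_i$, and $0$ otherwise; the skew-rank $sr(G^\sigma)$ is the rank of $S(G^\sigma)$. A pendant vertex is a vertex with exactly one neighbor. $S_m$ denotes the star on $m$ vertices ($K_{1,m-1}$) and $S_m^\sigma$ an orientation of it. For an even cycle $u_1\cdots u_ku_1$, its sign is the sign of $\prod_{i=1}^k s_{u_iu_{i+1}}$ ($u_{k+1}=u_1$); the cycle is evenly-oriented if this sign is positive.
   Formalization: The oriented graph is additionally assumed to have no isolated vertex (2K₂ plus an isolated vertex has a pendant vertex and skew-rank 4 but is of neither type); stars have at least two vertices and the parts of the complete multipartite graphs are nonempty. -}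

module Defs where

open import Level using (0ℓ) renaming (suc to lsuc)
open import Data.Nat using (ℕ; suc; _≤_; _<_; _∸_; NonZero)
open import Data.Nat.DivMod using (_mod_)
open import Data.Fin using (Fin; zero; toℕ)
open import Data.Vec using (Vec; []; _∷_; lookup) renaming (sum to sumᵛ)
open import Data.Rational using (ℚ; 0ℚ; 1ℚ; -_; _*_; Positive)
open import Data.Rational.Properties using (+-0-commutativeMonoid; *-1-commutativeMonoid)
open import Data.Product using (Σ; Σ-syntax; ∃; ∃!; ∃-syntax; _×_; _,_; proj₁)
open import Data.Sum using (_⊎_; inj₁; inj₂)
open import Function using (_∘_; _↔_; _⇔_; Inverse)
open import Function.Definitions using (Injective)
open import Relation.Nullary using (yes; no)
open import Relation.Binary using (Rel; Decidable; Asymmetric)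
open import Relation.Binary.PropositionalEquality using (_≡_; _≢_)
open import Algebra.Properties.CommutativeMonoid.Sum +-0-commutativeMonoid using (sum)
open import Algebra.Properties.CommutativeMonoid.Sum *-1-commutativeMonoid
  renaming (sum to product) using ()

-- Asymmetry rules out loops and opposite arcs, so the underlying graph `Adj`
-- is simple and each of its edges has exactly one orientation.
record OrientedGraph (V : Set) : Set₁ where
  infix 4 _⟶_ _⟶?_
  field
    _⟶_  : Rel V 0ℓ
    _⟶?_ : Decidable _⟶_
    asym : Asymmetric _⟶_

  Adj : Rel V 0ℓ
  Adj x y = x ⟶ y ⊎ y ⟶ x

open OrientedGraph using (Adj)

module _ {V : Set} (G : OrientedGraph V) where
  open OrientedGraph G using (_⟶_; _⟶?_)

  skewAdjacency : V → V → ℚ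
  skewAdjacency x y with x ⟶? y | y ⟶? x
  ... | yes _ | _     = 1ℚ
  ... | no  _ | yes _ = - 1ℚ
  ... | no  _ | no  _ = 0ℚ

  IsPendant : V → Set
  IsPendant v = ∃! _≡_ (Adj G v)

  HasPendantVertex : Set
  HasPendantVertex = ∃[ v ] IsPendant v

  NoIsolatedVertex : Set
  NoIsolatedVertex = ∀ v → ∃[ u ] Adj G v u

  module _ {k : ℕ} .{{_ : NonZero k}} where

    next : Fin k → Fin k
    next i = suc (toℕ i) mod k

    record IsCycle (u : Fin k → V) : Set where
      field
        length≥3 : 3 ≤ k
        distinct : Injective _≡_ _≡_ u
        edges    : ∀ i → Adj G (u i) (u (next i))

    -- Only meaningful for even k: reversing the direction of traversal
    -- multiplies the product by (-1)^k.
    EvenlyOriented : (Fin k → V) → Set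
    EvenlyOriented u = Positive (product (λ i → skewAdjacency (u i) (u (next i))))

  Every4CycleEvenlyOriented : Set
  Every4CycleEvenlyOriented = (u : Fin 4 → V) → IsCycle u → EvenlyOriented u

-- The matrices of interest have entries in {-1,0,1}; their rank over ℚ is
-- their rank over any field of characteristic zero.
Matrix : ℕ → ℕ → Set
Matrix m n = Fin m → Fin n → ℚ

LinearlyIndependent : ∀ {k n} → (Fin k → Fin n → ℚ) → Set
LinearlyIndependent {k} v =
  (a : Fin k → ℚ) → (∀ j → sum (λ i → a i * v i j) ≡ 0ℚ) → ∀ i → a i ≡ 0ℚ

-- The rank is the largest number of linearly independent rows.  A linearly
-- independent family has no repetitions, so injectivity of ρ need not be asked.
HasRank : ∀ {m n} → Matrix m n → ℕ → Set
HasRank {m} A r =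
  (Σ[ ρ ∈ (Fin r → Fin m) ] LinearlyIndependent (A ∘ ρ)) ×
  (∀ k (ρ : Fin k → Fin m) → LinearlyIndependent (A ∘ ρ) → k ≤ r)

HasSkewRank : ∀ {n} → OrientedGraph (Fin n) → ℕ → Set
HasSkewRank G r = HasRank (skewAdjacency G) r

-- Vertices of K_{n₁,…,n_k}, tagged by the part they belong to.
PartVertex : ∀ {k} → Vec ℕ k → Set
PartVertex {k} ns = Σ (Fin k) (Fin ∘ lookup ns)

-- An orientation of the complete multipartite graph K_{n₁,…,n_k}.  As usual,
-- the parts are nonempty.
record OrientedCompleteMultipartite {k} (ns : Vec ℕ k) : Set₁ where
  field
    graph    : OrientedGraph (PartVertex ns)
    nonempty : ∀ p → 0 < lookup ns p
    complete : ∀ x y → Adj graph x y ⇔ proj₁ x ≢ proj₁ y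

open OrientedCompleteMultipartite using (graph)

-- S_m = K_{1,m-1}; nonemptiness of the parts forces m ≥ 2.
OrientedStar : ℕ → Set₁
OrientedStar m = OrientedCompleteMultipartite (1 ∷ (m ∸ 1) ∷ [])

centre : ∀ m → PartVertex (1 ∷ (m ∸ 1) ∷ [])
centre m = zero , zero

-- Up to the relabelling `vertices`, G is the disjoint union of S and K with
-- further edges inserted between the vertex c of S and vertices of K.  The
-- set of inserted edges and their orientations are unconstrained.
record ObtainedByInserting {A B V : Set}
         (S : OrientedGraph A) (c : A) (K : OrientedGraph B)
         (G : OrientedGraph V) : Set where
  open OrientedGraph S using () renaming (_⟶_ to _⟶ˢ_)
  open OrientedGraph K using () renaming (_⟶_ to _⟶ᵏ_)
  open OrientedGraph G using () renaming (_⟶_ to _⟶ᵍ_)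
  field
    vertices : (A ⊎ B) ↔ V

  ⟦_⟧ : A ⊎ B → V
  ⟦_⟧ = Inverse.to vertices

  field
    arcsˢ    : ∀ x y → (x ⟶ˢ y) ⇔ (⟦ inj₁ x ⟧ ⟶ᵍ ⟦ inj₁ y ⟧)
    arcsᵏ    : ∀ x y → (x ⟶ᵏ y) ⇔ (⟦ inj₂ x ⟧ ⟶ᵍ ⟦ inj₂ y ⟧)
    inserted : ∀ x y → Adj G ⟦ inj₁ x ⟧ ⟦ inj₂ y ⟧ → x ≡ c

StarWithMultipartite : ∀ {k n} → Vec ℕ k → OrientedGraph (Fin n) → Set₁
StarWithMultipartite {n = n} ns G =
  Σ[ S ∈ OrientedStar m ] Σ[ K ∈ OrientedCompleteMultipartite ns ]
    Every4CycleEvenlyOriented (graph K) ×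
    ObtainedByInserting (graph S) (centre m) (graph K) G
  where
  m : ℕ
  m = n ∸ sumᵛ ns

{-# OPTIONS --safe #-}
-- Let v be a pendant vertex with neighbour c and s the skew-adjacency matrix.
-- The rows of v and c contribute 2 to the rank whatever the rest of the graph
-- is, so the rank is 4 exactly when G - c has an edge and all its Pfaffians
--   s_pq s_xy - s_px s_qy + s_py s_qx
-- vanish.  For an edge pq the entry s_xy is then, up to sign, the determinant
-- of (s_xp , s_xq) and (s_yp , s_yq).  The nonzero vectors of {-1,0,1}² whose
-- pairwise determinants stay in {-1,0,1} fall into at most three classes up to
-- sign, and these are the parts; the zero vector marks the leaves of the star.
-- On a complete multipartite graph with at most three parts, vanishing of the
-- Pfaffians amounts to all 4-cycles being evenly-oriented, since among four
-- vertices two lie in the same part.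
module Submission where

open import Defs
open import Level using (0ℓ)
open import Data.Nat as ℕ using (ℕ; zero; suc; z≤n; s≤s; _∸_)
import Data.Nat.Properties as ℕ
open import Data.Fin using (Fin; zero; suc; punchIn; punchOut; fromℕ<)
open import Data.Fin.Patterns
open import Data.Fin.Permutation using (↔⇒≡)
open import Data.Fin.Properties using (any?; all?; punchIn-punchOut; punchIn-injective; suc-injective; +↔⊎)
  renaming (_≟_ to _≟ᶠ_)
open import Data.Vec using (Vec; lookup; tabulate) renaming (sum to sumᵛ)
open import Data.Vec.Properties using (lookup∘tabulate)
open import Data.Product using (Σ; Σ-syntax; ∃-syntax; _×_; _,_; proj₁; proj₂)
import Data.Product.Properties as Product
open import Data.Product.Function.Dependent.Propositional using (Σ-↔)
open import Data.Sum as Sum using (_⊎_; inj₁; inj₂; swap)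
open import Data.Sum.Function.Propositional using (_⊎-↔_)
open import Function using (_∘_; _⇔_; _↔_; mk⇔; mk↔ₛ′; Equivalence; Inverse)
open import Function.Construct.Identity using (↔-id; ⇔-id)
open import Function.Construct.Composition using (_↔-∘_)
open import Relation.Nullary
  using (¬_; Dec; yes; no; ¬?; contradiction; decidable-stable; from-yes; Irrelevant; _→-dec_; _×-dec_)
open import Relation.Unary using (Pred; Decidable)
open import Relation.Binary using (DecidableEquality)
open import Relation.Binary.PropositionalEquality
open import Axiom.UniquenessOfIdentityProofs using (module Decidable⇒UIP)

open OrientedGraph using (Adj)
open OrientedCompleteMultipartite using (graph; nonempty; complete)

module _ where
  open import Data.Nat using (_<_; _≤_)
  open import Data.Rational using (ℚ; 0ℚ; 1ℚ; -_; _*_; _+_; _-_; 1/_; NonZero; ≢-nonZero; positive)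
    renaming (_<_ to _<ℚ_)
  open import Data.Rational.Properties as ℚ using (+-*-commutativeRing; _≟_) renaming (_<?_ to _<ℚ?_)
  open import Data.Rational.Solver using (module +-*-Solver)
  open +-*-Solver using (solve; _:=_; _:+_; _:-_; _:*_; :-_; con)
  open import Data.Vec.Functional using (insertAt; _∷_; [])
  open import Data.Vec.Functional.Properties using (insertAt-lookup; insertAt-punchIn)
  open import Algebra.Bundles using (CommutativeRing)
  open import Algebra.Properties.Semiring.Sum (CommutativeRing.semiring +-*-commutativeRing)
    using (sum; sum-cong-≗; sum-remove; ∑-distrib-+; ∑-comm; *-distribˡ-sum; *-distribʳ-sum; sum-replicate-zero)

  -- Steinitz exchange over ℚ

  sum-zero : ∀ {k} (f : Fin k → ℚ) → (∀ i → f i ≡ 0ℚ) → sum f ≡ 0ℚ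
  sum-zero {k} f f≡0 = trans (sum-cong-≗ f≡0) (sum-replicate-zero k)

  -- Gaussian elimination on the first column. If that column is zero it is dropped; otherwise a
  -- pivot row clears it from the other rows, and both the number of rows and the number of columns
  -- go down by one.
  nontrivial-relation : ∀ {r k} → r < k → (B : Matrix k r) →
    Σ[ a ∈ (Fin k → ℚ) ] (∃[ i ] a i ≢ 0ℚ) × (∀ j → sum (λ i → a i * B i j) ≡ 0ℚ)
  nontrivial-relation {zero}  {suc k} _         B = (λ _ → 1ℚ) , (zero , λ ()) , λ ()
  nontrivial-relation {suc r} {suc k} (s≤s r<k) B
    with any? (λ i → ¬? (B i zero ℚ.≟ 0ℚ))
  ... | no none
    with a , nonzero , relation ← nontrivial-relation {r} {suc k} (ℕ.m<n⇒m<1+n r<k) (λ i → B i ∘ suc)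
    = a , nonzero , λ where
        zero    → sum-zero _ λ i → trans (cong (a i *_) (column-zero i)) (ℚ.*-zeroʳ (a i))
        (suc j) → relation j
    where
    column-zero : ∀ i → B i zero ≡ 0ℚ
    column-zero i = decidable-stable (B i zero ℚ.≟ 0ℚ) λ Bi≢0 → none (i , Bi≢0)
  ... | yes (i , Bi≢0)
    with a′ , (l , a′l≢0) , relation′ ← nontrivial-relation r<k
           (λ l j → B (punchIn i l) (suc j) + B (punchIn i l) zero * - (1/_ (B i zero) {{≢-nonZero Bi≢0}} * B i (suc j)))
    = a , (punchIn i l , subst (_≢ 0ℚ) (sym (insertAt-punchIn a′ i α l)) a′l≢0) , relation
    where
    instance
      pivot-nonZero : NonZero (B i zero)
      pivot-nonZero = ≢-nonZero Bi≢0
    b b⁻¹ α : ℚ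
    b = B i zero
    b⁻¹ = 1/ b
    column : Fin (suc r) → ℚ
    column j = sum (λ l → a′ l * B (punchIn i l) j)
    -- The coefficient forced on the pivot row by cancellation in column zero; in the other columns
    -- it reproduces the relation between the cleared rows.
    α = - (column zero * b⁻¹)
    a : Fin (suc k) → ℚ
    a = insertAt a′ i α
    split : ∀ j → sum (λ l → a l * B l j) ≡ α * B i j + column j
    split j = trans (sum-remove {i = i} (λ l → a l * B l j))
      (cong₂ _+_ (cong (_* B i j) (insertAt-lookup a′ i α))
                 (sum-cong-≗ λ l → cong (_* B (punchIn i l) j) (insertAt-punchIn a′ i α l)))
    open ≡-Reasoning
    relation : ∀ j → sum (λ l → a l * B l j) ≡ 0ℚ
    relation zero = begin
      sum (λ l → a l * B l zero)               ≡⟨ split zero ⟩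
      - (column zero * b⁻¹) * b + column zero  ≡⟨ solve 3 (λ c b′ b → :- (c :* b′) :* b :+ c := c :* (:- (b′ :* b) :+ con 1ℚ)) refl (column zero) b⁻¹ b ⟩
      column zero * (- (b⁻¹ * b) + 1ℚ)         ≡⟨ cong (λ u → column zero * (- u + 1ℚ)) (ℚ.*-inverseˡ b) ⟩
      column zero * 0ℚ                         ≡⟨ ℚ.*-zeroʳ (column zero) ⟩
      0ℚ                                       ∎
    relation (suc j) = begin
      sum (λ l → a l * B l (suc j))            ≡⟨ split (suc j) ⟩
      α * B i (suc j) + column (suc j)
        ≡⟨ solve 4 (λ c b′ y c′ → :- (c :* b′) :* y :+ c′ := c′ :+ c :* :- (b′ :* y)) refl (column zero) b⁻¹ (B i (suc j)) (column (suc j)) ⟩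
      column (suc j) + column zero * m         ≡⟨ cong (column (suc j) +_) (*-distribʳ-sum m (λ l → a′ l * B (punchIn i l) zero)) ⟩
      column (suc j) + sum (λ l → a′ l * B (punchIn i l) zero * m)
        ≡⟨ ∑-distrib-+ (λ l → a′ l * B (punchIn i l) (suc j)) _ ⟨
      sum (λ l → a′ l * B (punchIn i l) (suc j) + a′ l * B (punchIn i l) zero * m)
        ≡⟨ sum-cong-≗ (λ l → solve 4 (λ a x y m → a :* x :+ a :* y :* m := a :* (x :+ y :* m)) refl (a′ l) (B (punchIn i l) (suc j)) (B (punchIn i l) zero) m) ⟩
      sum (λ l → a′ l * (B (punchIn i l) (suc j) + B (punchIn i l) zero * m))
        ≡⟨ relation′ j ⟩
      0ℚ ∎
      where
      m : ℚ
      m = - (b⁻¹ * B i (suc j))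

  -- If `r < k`, the coefficient rows of `B` satisfy a nontrivial relation, and exchanging the two
  -- sums carries it over to the rows of `v`.
  independent-in-span : ∀ {k r n} {v : Matrix k n} (w : Matrix r n) (B : Matrix k r) →
    (∀ i j → v i j ≡ sum (λ l → B i l * w l j)) → LinearlyIndependent v → k ≤ r
  independent-in-span {v = v} w B v≡Bw independent = ℕ.≮⇒≥ λ r<k →
    let a , (i , ai≢0) , relation = nontrivial-relation r<k B
    in ai≢0 (independent a (λ j → begin
      sum (λ i → a i * v i j)
        ≡⟨ sum-cong-≗ (λ i → trans (cong (a i *_) (v≡Bw i j)) (*-distribˡ-sum (a i) (λ l → B i l * w l j))) ⟩
      sum (λ i → sum (λ l → a i * (B i l * w l j)))
        ≡⟨ ∑-comm (λ i l → a i * (B i l * w l j)) ⟩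
      sum (λ l → sum (λ i → a i * (B i l * w l j)))
        ≡⟨ sum-zero _ (λ l → begin
             sum (λ i → a i * (B i l * w l j))  ≡⟨ sum-cong-≗ (λ i → sym (ℚ.*-assoc (a i) (B i l) (w l j))) ⟩
             sum (λ i → a i * B i l * w l j)    ≡⟨ *-distribʳ-sum (w l j) (λ i → a i * B i l) ⟨
             sum (λ i → a i * B i l) * w l j    ≡⟨ cong (_* w l j) (relation l) ⟩
             0ℚ * w l j                         ≡⟨ ℚ.*-zeroˡ (w l j) ⟩
             0ℚ                                 ∎) ⟩
      0ℚ ∎) i)
    where open ≡-Reasoning

  -- Skew-adjacency matrices and pendant vertices

  -- Indexing the values 0, 1, -1 by a finite type lets identities and implications between matrix
  -- entries be settled by exhaustive decision.
  sign : Fin 3 → ℚ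
  sign 0F = 0ℚ
  sign 1F = 1ℚ
  sign 2F = - 1ℚ

  IsSign : ℚ → Set
  IsSign x = ∃[ t ] x ≡ sign t

  integral-domain : ∀ {x y} → x ≢ 0ℚ → x * y ≡ 0ℚ → y ≡ 0ℚ
  integral-domain {x} {y} x≢0 xy≡0 = begin
    y               ≡⟨ ℚ.*-identityˡ y ⟨
    1ℚ * y          ≡⟨ cong (_* y) (ℚ.*-inverseˡ x) ⟨
    1/ x * x * y    ≡⟨ ℚ.*-assoc (1/ x) x y ⟩
    1/ x * (x * y)  ≡⟨ cong (1/ x *_) xy≡0 ⟩
    1/ x * 0ℚ       ≡⟨ ℚ.*-zeroʳ (1/ x) ⟩
    0ℚ              ∎
    where
    open ≡-Reasoning
    instance _ = ≢-nonZero x≢0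

  sign-square : ∀ {x} → IsSign x → x ≢ 0ℚ → x * x ≡ 1ℚ
  sign-square (0F , refl) x≢0 = contradiction refl x≢0
  sign-square (1F , refl) _   = refl
  sign-square (2F , refl) _   = refl

  -- The Pfaffian of the principal block on p, q, x, y when `M` is skew-symmetric. The vertices may
  -- coincide, in which case it vanishes.
  pfaffian : {V : Set} → (V → V → ℚ) → V → V → V → V → ℚ
  pfaffian M p q x y = M p q * M x y - M p x * M q y + M p y * M q x

  module _ {V : Set} (G : OrientedGraph V) where
    open OrientedGraph G using (_⟶_; _⟶?_; asym)

    private
      s : V → V → ℚ
      s = skewAdjacency G

    skew-sign : ∀ x y → IsSign (s x y)
    skew-sign x y with x ⟶? y | y ⟶? x
    ... | yes _ | _     = 1F , refl
    ... | no  _ | yes _ = 2F , refl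
    ... | no  _ | no  _ = 0F , refl

    skew-antisym : ∀ x y → s y x ≡ - s x y
    skew-antisym x y with x ⟶? y | y ⟶? x
    ... | yes xy | yes yx = contradiction yx (asym xy)
    ... | yes _  | no  _  = refl
    ... | no  _  | yes _  = refl
    ... | no  _  | no  _  = refl

    skew-diag : ∀ x → s x x ≡ 0ℚ
    skew-diag x with x ⟶? x
    ... | yes xx = contradiction xx (asym xx)
    ... | no  _  = refl

    adj⇒≢0 : ∀ {x y} → Adj G x y → s x y ≢ 0ℚ
    adj⇒≢0 {x} {y} xy with x ⟶? y | y ⟶? x
    adj⇒≢0 _ | yes _ | _     = λ ()
    adj⇒≢0 _ | no  _ | yes _ = λ ()
    adj⇒≢0 (inj₁ xy) | no ¬xy | no _ = contradiction xy ¬xy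
    adj⇒≢0 (inj₂ yx) | no _ | no ¬yx = contradiction yx ¬yx

    ≢0⇒adj : ∀ {x y} → s x y ≢ 0ℚ → Adj G x y
    ≢0⇒adj {x} {y} s≢0 with x ⟶? y | y ⟶? x
    ... | yes xy | _      = inj₁ xy
    ... | no  _  | yes yx = inj₂ yx
    ... | no  _  | no  _  = contradiction refl s≢0

    ¬adj⇒≡0 : ∀ {x y} → ¬ Adj G x y → s x y ≡ 0ℚ
    ¬adj⇒≡0 {x} {y} ¬xy with s x y ≟ 0ℚ
    ... | yes ≡0 = ≡0
    ... | no  ≢0 = contradiction (≢0⇒adj ≢0) ¬xy

    skew-square : ∀ {x y} → Adj G x y → s x y * s x y ≡ 1ℚ
    skew-square xy = sign-square (skew-sign _ _) (adj⇒≢0 xy)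

    adj-irrefl : ∀ {x} → ¬ Adj G x x
    adj-irrefl {x} xx = adj⇒≢0 xx (skew-diag x)

  -- Entries depend only on which arcs exist, so they agree although the two graphs carry unrelated
  -- decision procedures.
  skew-cong : ∀ {U V : Set} (H : OrientedGraph U) (G : OrientedGraph V) (φ : U → V) →
    (∀ x y → OrientedGraph._⟶_ H x y ⇔ OrientedGraph._⟶_ G (φ x) (φ y)) →
    ∀ x y → skewAdjacency H x y ≡ skewAdjacency G (φ x) (φ y)
  skew-cong H G φ arcs x y
    with OrientedGraph._⟶?_ H x y | OrientedGraph._⟶?_ H y x
       | OrientedGraph._⟶?_ G (φ x) (φ y) | OrientedGraph._⟶?_ G (φ y) (φ x)
  ... | yes _ | _ | yes _ | _ = refl
  ... | no _ | yes _ | no _ | yes _ = refl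
  ... | no _ | no _ | no _ | no _ = refl
  ... | yes a | _ | no ¬b | _ = contradiction (Equivalence.to (arcs x y) a) ¬b
  ... | no ¬a | _ | yes b | _ = contradiction (Equivalence.from (arcs x y) b) ¬a
  ... | no _ | yes a | no _ | no ¬b = contradiction (Equivalence.to (arcs y x) a) ¬b
  ... | no _ | no ¬a | no _ | yes b = contradiction (Equivalence.from (arcs y x) b) ¬a

  pfaffian-cong : ∀ {U V : Set} (M : U → U → ℚ) (N : V → V → ℚ) (φ : U → V) →
    (∀ x y → M x y ≡ N (φ x) (φ y)) →
    ∀ p q x y → pfaffian M p q x y ≡ pfaffian N (φ p) (φ q) (φ x) (φ y)
  pfaffian-cong M N φ M≡N p q x y =
    cong₂ _+_ (cong₂ _-_ (cong₂ _*_ (M≡N p q) (M≡N x y)) (cong₂ _*_ (M≡N p x) (M≡N q y)))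
              (cong₂ _*_ (M≡N p y) (M≡N q x))

  -- Adding a pendant vertex v, attached at c, to the rows: independence and
  -- spanning only have to be checked off the column of c.
  module Pendant {n} (G : OrientedGraph (Fin n)) {v c : Fin n}
    (v–c : Adj G v c) (only-c : ∀ {u} → Adj G v u → c ≡ u) where

    s : Fin n → Fin n → ℚ
    s = skewAdjacency G

    row-v : ∀ {j} → j ≢ c → s v j ≡ 0ℚ
    row-v j≢c = ¬adj⇒≡0 G λ v–j → j≢c (sym (only-c v–j))

    column-v : ∀ {j} → j ≢ c → s j v ≡ 0ℚ
    column-v j≢c = ¬adj⇒≡0 G λ j–v → j≢c (sym (only-c (swap j–v)))

    v≢c : v ≢ c
    v≢c v≡c = adj-irrefl G (subst (Adj G v) (sym v≡c) v–c)

    -- Column v meets only the row of c, which kills the coefficient of that row. Off column c the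
    -- row of v vanishes, leaving a relation among the rows of `ρ`. Column c finally kills the
    -- coefficient of the row of v.
    pendant-independent : ∀ {k} (ρ : Fin k → Fin n) → (∀ i → ρ i ≢ c) →
      (∀ a → (∀ j → j ≢ c → sum (λ i → a i * s (ρ i) j) ≡ 0ℚ) → ∀ i → a i ≡ 0ℚ) →
      LinearlyIndependent (s ∘ (v ∷ c ∷ ρ))
    pendant-independent ρ ρ≢c independent a relation = λ where
        0F            → a₀≡0
        1F            → a₁≡0
        (suc (suc i)) → a≡0 i
      where
      open ≡-Reasoning
      S : Fin n → ℚ
      S j = sum (λ i → a (suc (suc i)) * s (ρ i) j)
      drop : ∀ x y z → x ≡ 0ℚ → z ≡ 0ℚ → x + (y + z) ≡ y
      drop x y z refl refl = trans (ℚ.+-identityˡ _) (ℚ.+-identityʳ y)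
      a₁≡0 : a 1F ≡ 0ℚ
      a₁≡0 = integral-domain (adj⇒≢0 G (swap v–c)) (begin
        s c v * a 1F                          ≡⟨ ℚ.*-comm (s c v) (a 1F) ⟩
        a 1F * s c v
          ≡⟨ drop (a 0F * s v v) _ (S v)
               (trans (cong (a 0F *_) (skew-diag G v)) (ℚ.*-zeroʳ (a 0F)))
               (sum-zero _ λ i → trans (cong (a (suc (suc i)) *_) (column-v (ρ≢c i))) (ℚ.*-zeroʳ (a (suc (suc i))))) ⟨
        a 0F * s v v + (a 1F * s c v + S v)  ≡⟨ relation v ⟩
        0ℚ                                   ∎)
      a≡0 : ∀ i → a (suc (suc i)) ≡ 0ℚ
      a≡0 = independent (λ i → a (suc (suc i))) λ j j≢c → begin
        S j                                  ≡⟨ ℚ.+-identityˡ (S j) ⟨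
        0ℚ + S j                             ≡⟨ ℚ.+-identityˡ (0ℚ + S j) ⟨
        0ℚ + (0ℚ + S j)
          ≡⟨ cong₂ (λ x y → x + (y + S j))
               (trans (cong (a 0F *_) (row-v j≢c)) (ℚ.*-zeroʳ (a 0F)))
               (trans (cong (_* s c j) a₁≡0) (ℚ.*-zeroˡ (s c j))) ⟨
        a 0F * s v j + (a 1F * s c j + S j)  ≡⟨ relation j ⟩
        0ℚ                                   ∎
      a₀≡0 : a 0F ≡ 0ℚ
      a₀≡0 = integral-domain (adj⇒≢0 G v–c) (begin
        s v c * a 0F                         ≡⟨ ℚ.*-comm (s v c) (a 0F) ⟩
        a 0F * s v c                         ≡⟨ ℚ.+-identityʳ _ ⟨
        a 0F * s v c + 0ℚ
          ≡⟨ cong (a 0F * s v c +_) (trans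
               (cong₂ _+_
                 (trans (cong (_* s c c) a₁≡0) (ℚ.*-zeroˡ (s c c)))
                 (sum-zero _ λ i → trans (cong (_* s (ρ i) c) (a≡0 i)) (ℚ.*-zeroˡ (s (ρ i) c))))
               (ℚ.+-identityˡ 0ℚ)) ⟨
        a 0F * s v c + (a 1F * s c c + S c)  ≡⟨ relation c ⟩
        0ℚ                                   ∎)

    -- The row of c represents itself. For any other row the error of the given expansion sits in
    -- column c alone, where the row of v has its only nonzero entry and can correct it.
    pendant-span : ∀ {k} (ρ : Fin k → Fin n) (B : Fin n → Fin k → ℚ) →
      (∀ {x j} → x ≢ c → j ≢ c → s x j ≡ sum (λ i → B x i * s (ρ i) j)) →
      ∀ m (σ : Fin m → Fin n) → LinearlyIndependent (s ∘ σ) → m ≤ suc (suc k)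
    pendant-span {k} ρ B span m σ =
      independent-in-span (s ∘ (v ∷ c ∷ ρ)) (B⁺ ∘ σ) (span⁺ ∘ σ)
      where
      open ≡-Reasoning
      S : Fin n → Fin n → ℚ
      S x j = sum (λ i → B x i * s (ρ i) j)
      B⁺ : Fin n → Fin (suc (suc k)) → ℚ
      B⁺ x with x ≟ᶠ c
      ... | yes _ = 0ℚ ∷ 1ℚ ∷ λ _ → 0ℚ
      -- The entry `s v c` is 1 or -1, hence its own inverse: multiplying by it replaces division.
      ... | no  _ = (s x c - S x c) * s v c ∷ 0ℚ ∷ B x
      span⁺ : ∀ x j → s x j ≡ sum (λ l → B⁺ x l * s ((v ∷ c ∷ ρ) l) j)
      span⁺ x j with x ≟ᶠ c
      ... | yes refl = sym (begin
        0ℚ * s v j + (1ℚ * s c j + sum (λ i → 0ℚ * s (ρ i) j))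
          ≡⟨ cong₂ (λ y z → y + (1ℚ * s c j + z)) (ℚ.*-zeroˡ (s v j)) (sum-zero _ λ i → ℚ.*-zeroˡ (s (ρ i) j)) ⟩
        0ℚ + (1ℚ * s c j + 0ℚ)
          ≡⟨ trans (ℚ.+-identityˡ _) (trans (ℚ.+-identityʳ _) (ℚ.*-identityˡ (s c j))) ⟩
        s c j ∎)
      ... | no x≢c with j ≟ᶠ c
      ...   | yes refl = sym (begin
        (s x c - S x c) * s v c * s v c + (0ℚ * s c c + S x c)
          ≡⟨ solve 4 (λ x y z w → (x :- y) :* z :* z :+ (con 0ℚ :* w :+ y) := (x :- y) :* (z :* z) :+ y) refl (s x c) (S x c) (s v c) (s c c) ⟩
        (s x c - S x c) * (s v c * s v c) + S x c
          ≡⟨ cong (λ u → (s x c - S x c) * u + S x c) (skew-square G v–c) ⟩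
        (s x c - S x c) * 1ℚ + S x c
          ≡⟨ solve 2 (λ x y → (x :- y) :* con 1ℚ :+ y := x) refl (s x c) (S x c) ⟩
        s x c ∎)
      ...   | no j≢c = sym (begin
        (s x c - S x c) * s v c * s v j + (0ℚ * s c j + S x j)
          ≡⟨ cong (λ u → (s x c - S x c) * s v c * u + (0ℚ * s c j + S x j)) (row-v j≢c) ⟩
        (s x c - S x c) * s v c * 0ℚ + (0ℚ * s c j + S x j)
          ≡⟨ solve 3 (λ x w y → x :* con 0ℚ :+ (con 0ℚ :* w :+ y) := y) refl ((s x c - S x c) * s v c) (s c j) (S x j) ⟩
        S x j ≡⟨ span x≢c j≢c ⟨
        s x j ∎)

  -- Pfaffians

  -- a, b, c, d are the entries along a 4-cycle, e and f those of its diagonals;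
  -- the hypothesis is that the Pfaffian vanishes, where s₀₃ = - s₃₀.
  cycle-sign : ∀ a b c d e f → sign a ≢ 0ℚ → sign b ≢ 0ℚ → sign c ≢ 0ℚ → sign d ≢ 0ℚ →
    sign a * sign c - sign e * sign f + - sign d * sign b ≡ 0ℚ →
    0ℚ <ℚ sign a * (sign b * (sign c * (sign d * 1ℚ)))
  cycle-sign = from-yes (all? λ a → all? λ b → all? λ c → all? λ d → all? λ e → all? λ f →
    ¬? (sign a ≟ 0ℚ) →-dec ¬? (sign b ≟ 0ℚ) →-dec ¬? (sign c ≟ 0ℚ) →-dec ¬? (sign d ≟ 0ℚ) →-dec
    (sign a * sign c - sign e * sign f + - sign d * sign b ≟ 0ℚ) →-dec
    (0ℚ <ℚ? sign a * (sign b * (sign c * (sign d * 1ℚ)))))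

  -- Converse for a 4-cycle with a missing diagonal, where the term e f drops out of the Pfaffian.
  -- Positivity already makes all four entries nonzero.
  cycle-sign⁻¹ : ∀ a b c d → 0ℚ <ℚ sign a * (sign b * (sign c * (sign d * 1ℚ))) →
    sign a * sign c + - sign d * sign b ≡ 0ℚ
  cycle-sign⁻¹ = from-yes (all? λ a → all? λ b → all? λ c → all? λ d →
    (0ℚ <ℚ? sign a * (sign b * (sign c * (sign d * 1ℚ)))) →-dec
    (sign a * sign c + - sign d * sign b ≟ 0ℚ))

  sign-* : ∀ {x y} → IsSign x → IsSign y → IsSign (x * y)
  sign-* (a , refl) (b , refl) = closed a b
    where
    closed : ∀ a b → IsSign (sign a * sign b)
    closed = from-yes (all? λ a → all? λ b → any? λ t → sign a * sign b ≟ sign t)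

  -- Vectors up to sign. Class `3F` contains both (1, 1) and (1, -1), which are not proportional;
  -- their determinant is 2 or -2, so they never occur together when determinants are signs.
  class : ℚ → ℚ → Fin 4
  class α β with α ≟ 0ℚ | β ≟ 0ℚ
  ... | yes _ | yes _ = 0F
  ... | yes _ | no  _ = 1F
  ... | no  _ | yes _ = 2F
  ... | no  _ | no  _ = 3F

  class-0-0 : ∀ {α β} → α ≡ 0ℚ → β ≡ 0ℚ → class α β ≡ 0F
  class-0-0 refl refl = refl

  class-0-≢0 : ∀ {α β} → α ≡ 0ℚ → β ≢ 0ℚ → class α β ≡ 1F
  class-0-≢0 {β = β} refl β≢0 with β ≟ 0ℚ
  ... | yes β≡0 = contradiction β≡0 β≢0
  ... | no  _   = refl

  class-≢0-0 : ∀ {α β} → α ≢ 0ℚ → β ≡ 0ℚ → class α β ≡ 2F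
  class-≢0-0 {α} α≢0 refl with α ≟ 0ℚ
  ... | yes α≡0 = contradiction α≡0 α≢0
  ... | no  _   = refl

  Separated : Fin 4 → Fin 4 → Set
  Separated i j = i ≢ 0F × j ≢ 0F × i ≢ j

  separated? : ∀ i j → Dec (Separated i j)
  separated? i j = ¬? (i ≟ᶠ 0F) ×-dec ¬? (j ≟ᶠ 0F) ×-dec ¬? (i ≟ᶠ j)

  -- A finite check. The hypothesis that the determinant is itself a sign excludes the pairs inside
  -- class `3F` with determinant 2 or -2.
  det≢0⇔separated : ∀ m α β γ δ → sign m ≡ sign α * sign δ - sign γ * sign β →
    (sign m ≢ 0ℚ → Separated (class (sign α) (sign β)) (class (sign γ) (sign δ))) ×
    (Separated (class (sign α) (sign β)) (class (sign γ) (sign δ)) → sign m ≢ 0ℚ)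
  det≢0⇔separated = from-yes (all? λ m → all? λ α → all? λ β → all? λ γ → all? λ δ →
    (sign m ≟ sign α * sign δ - sign γ * sign β) →-dec
    ((¬? (sign m ≟ 0ℚ) →-dec separated? (class (sign α) (sign β)) (class (sign γ) (sign δ))) ×-dec
     (separated? (class (sign α) (sign β)) (class (sign γ) (sign δ)) →-dec ¬? (sign m ≟ 0ℚ))))

  module _ {V : Set} (G : OrientedGraph V) where
    private
      s : V → V → ℚ
      s = skewAdjacency G

    pfaffian≡0⇒even : (∀ p q x y → pfaffian s p q x y ≡ 0ℚ) → Every4CycleEvenlyOriented G
    pfaffian≡0⇒even pf≡0 u cycle = positive (signs
      (skew-sign G _ _) (skew-sign G _ _) (skew-sign G _ _) (skew-sign G _ _)
      (skew-sign G _ _) (skew-sign G _ _)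
      (edge 0F) (edge 1F) (edge 2F) (edge 3F)
      (trans (cong (λ z → s (u 0F) (u 1F) * s (u 2F) (u 3F) - s (u 0F) (u 2F) * s (u 1F) (u 3F) + z * s (u 1F) (u 2F))
                   (sym (skew-antisym G (u 3F) (u 0F))))
             (pf≡0 (u 0F) (u 1F) (u 2F) (u 3F))))
      where
      edge : ∀ i → s (u i) (u (next G i)) ≢ 0ℚ
      edge i = adj⇒≢0 G (IsCycle.edges cycle i)
      signs : ∀ {a b c d e f} → IsSign a → IsSign b → IsSign c → IsSign d → IsSign e → IsSign f →
        a ≢ 0ℚ → b ≢ 0ℚ → c ≢ 0ℚ → d ≢ 0ℚ → a * c - e * f + - d * b ≡ 0ℚ →
        0ℚ <ℚ a * (b * (c * (d * 1ℚ)))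
      signs (a , refl) (b , refl) (c , refl) (d , refl) (e , refl) (f , refl) = cycle-sign a b c d e f

    -- The Pfaffian is alternating. This and the next two adjacent transpositions suffice to bring
    -- any two of the four vertices to the first and third places.
    pfaffian-swap₁₂ : ∀ {p q x y} → pfaffian s q p x y ≡ 0ℚ → pfaffian s p q x y ≡ 0ℚ
    pfaffian-swap₁₂ {p} {q} {x} {y} pf≡0 = begin
      s p q * s x y - s p x * s q y + s p y * s q x
        ≡⟨ cong (λ u → u * s x y - s p x * s q y + s p y * s q x) (skew-antisym G q p) ⟩
      - s q p * s x y - s p x * s q y + s p y * s q x
        ≡⟨ solve 6 (λ a b c d e f → :- a :* b :- c :* d :+ e :* f := :- (a :* b :- f :* e :+ d :* c)) refl
             (s q p) (s x y) (s p x) (s q y) (s p y) (s q x) ⟩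
      - pfaffian s q p x y ≡⟨ cong -_ pf≡0 ⟩
      0ℚ ∎
      where open ≡-Reasoning

    pfaffian-swap₂₃ : ∀ {p q x y} → pfaffian s p x q y ≡ 0ℚ → pfaffian s p q x y ≡ 0ℚ
    pfaffian-swap₂₃ {p} {q} {x} {y} pf≡0 = begin
      s p q * s x y - s p x * s q y + s p y * s q x
        ≡⟨ cong (λ u → s p q * s x y - s p x * s q y + s p y * u) (skew-antisym G x q) ⟩
      s p q * s x y - s p x * s q y + s p y * - s x q
        ≡⟨ solve 6 (λ a b c d e f → a :* b :- c :* d :+ e :* (:- f) := :- (c :* d :- a :* b :+ e :* f)) refl
             (s p q) (s x y) (s p x) (s q y) (s p y) (s x q) ⟩
      - pfaffian s p x q y ≡⟨ cong -_ pf≡0 ⟩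
      0ℚ ∎
      where open ≡-Reasoning

    pfaffian-swap₃₄ : ∀ {p q x y} → pfaffian s p q y x ≡ 0ℚ → pfaffian s p q x y ≡ 0ℚ
    pfaffian-swap₃₄ {p} {q} {x} {y} pf≡0 = begin
      s p q * s x y - s p x * s q y + s p y * s q x
        ≡⟨ cong (λ u → s p q * u - s p x * s q y + s p y * s q x) (skew-antisym G y x) ⟩
      s p q * - s y x - s p x * s q y + s p y * s q x
        ≡⟨ solve 6 (λ a b c d e f → a :* (:- b) :- c :* d :+ e :* f := :- (a :* b :- e :* f :+ c :* d)) refl
             (s p q) (s y x) (s p x) (s q y) (s p y) (s q x) ⟩
      - pfaffian s p q y x ≡⟨ cong -_ pf≡0 ⟩
      0ℚ ∎
      where open ≡-Reasoning

    -- A relation among the rows p, q, x, y, restricted to the columns p, q, x, y,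
    -- is killed by the adjugate of this 4 × 4 block, which is the Pfaffian times
    -- the matrix of complementary entries.
    pfaffian-independent : ∀ {p q x y} → pfaffian s p q x y ≢ 0ℚ → (a : Fin 4 → ℚ) →
      (∀ j → sum (λ i → a i * s ((p ∷ q ∷ x ∷ y ∷ []) i) ((p ∷ q ∷ x ∷ y ∷ []) j)) ≡ 0ℚ) →
      ∀ i → a i ≡ 0ℚ
    pfaffian-independent {p} {q} {x} {y} pf≢0 a relation i = integral-domain pf≢0 (killed i)
      where
      A B C D E F : ℚ
      A = s p q
      B = s p x
      C = s p y
      D = s q x
      E = s q y
      F = s x y
      combine : ∀ k l m {R S T} → R ≡ 0ℚ → S ≡ 0ℚ → T ≡ 0ℚ → k * R + l * S + m * T ≡ 0ℚ
      combine k l m refl refl refl =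
        solve 3 (λ k l m → k :* con 0ℚ :+ l :* con 0ℚ :+ m :* con 0ℚ := con 0ℚ) refl k l m
      column : ∀ j {b₀ b₁ b₂ b₃} →
        s p ((p ∷ q ∷ x ∷ y ∷ []) j) ≡ b₀ → s q ((p ∷ q ∷ x ∷ y ∷ []) j) ≡ b₁ →
        s x ((p ∷ q ∷ x ∷ y ∷ []) j) ≡ b₂ → s y ((p ∷ q ∷ x ∷ y ∷ []) j) ≡ b₃ →
        a 0F * b₀ + (a 1F * b₁ + (a 2F * b₂ + (a 3F * b₃ + 0ℚ))) ≡ 0ℚ
      column j refl refl refl refl = relation j
      -- The four column relations, with entries below the diagonal written as negatives of those
      -- above, so that the solver meets only the six unknown entries `A` to `F`.
      Rp = column 0F (skew-diag G p) (skew-antisym G p q) (skew-antisym G p x) (skew-antisym G p y)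
      Rq = column 1F refl (skew-diag G q) (skew-antisym G q x) (skew-antisym G q y)
      Rx = column 2F refl refl (skew-diag G x) (skew-antisym G x y)
      Ry = column 3F refl refl refl (skew-diag G y)
      killed : ∀ i → pfaffian s p q x y * a i ≡ 0ℚ
      killed 0F = trans
        (solve 10 (λ a b c d e f k l m n → (a :* f :- b :* e :+ c :* d) :* k :=
          f :* (k :* a :+ (l :* con 0ℚ :+ (m :* (:- d) :+ (n :* (:- e) :+ con 0ℚ)))) :+
          (:- e) :* (k :* b :+ (l :* d :+ (m :* con 0ℚ :+ (n :* (:- f) :+ con 0ℚ)))) :+
          d :* (k :* c :+ (l :* e :+ (m :* f :+ (n :* con 0ℚ :+ con 0ℚ)))))
          refl A B C D E F (a 0F) (a 1F) (a 2F) (a 3F))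
        (combine F (- E) D Rq Rx Ry)
      killed 1F = trans
        (solve 10 (λ a b c d e f k l m n → (a :* f :- b :* e :+ c :* d) :* l :=
          (:- f) :* (k :* con 0ℚ :+ (l :* (:- a) :+ (m :* (:- b) :+ (n :* (:- c) :+ con 0ℚ)))) :+
          c :* (k :* b :+ (l :* d :+ (m :* con 0ℚ :+ (n :* (:- f) :+ con 0ℚ)))) :+
          (:- b) :* (k :* c :+ (l :* e :+ (m :* f :+ (n :* con 0ℚ :+ con 0ℚ)))))
          refl A B C D E F (a 0F) (a 1F) (a 2F) (a 3F))
        (combine (- F) C (- B) Rp Rx Ry)
      killed 2F = trans
        (solve 10 (λ a b c d e f k l m n → (a :* f :- b :* e :+ c :* d) :* m :=
          e :* (k :* con 0ℚ :+ (l :* (:- a) :+ (m :* (:- b) :+ (n :* (:- c) :+ con 0ℚ)))) :+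
          (:- c) :* (k :* a :+ (l :* con 0ℚ :+ (m :* (:- d) :+ (n :* (:- e) :+ con 0ℚ)))) :+
          a :* (k :* c :+ (l :* e :+ (m :* f :+ (n :* con 0ℚ :+ con 0ℚ)))))
          refl A B C D E F (a 0F) (a 1F) (a 2F) (a 3F))
        (combine E (- C) A Rp Rq Ry)
      killed 3F = trans
        (solve 10 (λ a b c d e f k l m n → (a :* f :- b :* e :+ c :* d) :* n :=
          (:- d) :* (k :* con 0ℚ :+ (l :* (:- a) :+ (m :* (:- b) :+ (n :* (:- c) :+ con 0ℚ)))) :+
          b :* (k :* a :+ (l :* con 0ℚ :+ (m :* (:- d) :+ (n :* (:- e) :+ con 0ℚ)))) :+
          (:- a) :* (k :* b :+ (l :* d :+ (m :* con 0ℚ :+ (n :* (:- f) :+ con 0ℚ)))))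
          refl A B C D E F (a 0F) (a 1F) (a 2F) (a 3F))
        (combine (- D) B (- A) Rp Rq Rx)

    -- The vanishing Pfaffian expresses `s p q * s x y` as a determinant. This product is again a
    -- sign and has the same zeros as `s x y`, so the finite check applies to it directly.
    pfaffian≡0⇒adj⇔separated : ∀ {p q x y} → Adj G p q → pfaffian s p q x y ≡ 0ℚ →
      Adj G x y ⇔ Separated (class (s x p) (s x q)) (class (s y p) (s y q))
    pfaffian≡0⇒adj⇔separated {p} {q} {x} {y} p–q pf≡0 = mk⇔
      (λ x–y → proj₁ det-sign λ m≡0 → adj⇒≢0 G x–y (integral-domain (adj⇒≢0 G p–q) m≡0))
      (λ separated → ≢0⇒adj G λ xy≡0 →
        proj₂ det-sign separated (trans (cong (s p q *_) xy≡0) (ℚ.*-zeroʳ (s p q))))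
      where
      open ≡-Reasoning
      det : s p q * s x y ≡ s x p * s y q - s y p * s x q
      det = begin
        s p q * s x y
          ≡⟨ solve 5 (λ a b c d e → a := (a :- b :* c :+ d :* e) :+ (b :* c :- d :* e)) refl
               (s p q * s x y) (s p x) (s q y) (s p y) (s q x) ⟩
        pfaffian s p q x y + (s p x * s q y - s p y * s q x)  ≡⟨ cong (_+ (s p x * s q y - s p y * s q x)) pf≡0 ⟩
        0ℚ + (s p x * s q y - s p y * s q x)
          ≡⟨ cong (0ℚ +_) (cong₂ _-_ (cong₂ _*_ (skew-antisym G x p) (skew-antisym G y q))
                                     (cong₂ _*_ (skew-antisym G y p) (skew-antisym G x q))) ⟩
        0ℚ + (- s x p * - s y q - - s y p * - s x q)
          ≡⟨ solve 4 (λ a b c d → con 0ℚ :+ ((:- a) :* (:- b) :- (:- c) :* (:- d)) := a :* b :- c :* d) refl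
               (s x p) (s y q) (s y p) (s x q) ⟩
        s x p * s y q - s y p * s x q ∎
      signs : ∀ {m α β γ δ} → IsSign m → IsSign α → IsSign β → IsSign γ → IsSign δ → m ≡ α * δ - γ * β →
        (m ≢ 0ℚ → Separated (class α β) (class γ δ)) × (Separated (class α β) (class γ δ) → m ≢ 0ℚ)
      signs (m , refl) (α , refl) (β , refl) (γ , refl) (δ , refl) = det≢0⇔separated m α β γ δ
      det-sign = signs (sign-* (skew-sign G p q) (skew-sign G x y))
        (skew-sign G x p) (skew-sign G x q) (skew-sign G y p) (skew-sign G y q) det

  -- Skew-rank four in terms of Pfaffians

  module PendantRank {n} (G : OrientedGraph (Fin n)) {v c : Fin n}
    (v–c : Adj G v c) (only-c : ∀ {u} → Adj G v u → c ≡ u) where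

    open Pendant G v–c only-c

    -- A nonzero Pfaffian would make the six rows v, c, p, q, x, y independent.
    rank4⇒pfaffian≡0 : HasSkewRank G 4 →
      ∀ {p q x y} → p ≢ c → q ≢ c → x ≢ c → y ≢ c → pfaffian s p q x y ≡ 0ℚ
    rank4⇒pfaffian≡0 (_ , at-most-4) {p} {q} {x} {y} p≢c q≢c x≢c y≢c =
      decidable-stable (pfaffian s p q x y ≟ 0ℚ) λ pf≢0 →
        contradiction (at-most-4 6 (v ∷ c ∷ ρ)
          (pendant-independent ρ ρ≢c λ a relation →
            pfaffian-independent G pf≢0 a λ j → relation (ρ j) (ρ≢c j)))
          (ℕ.<⇒≱ (s≤s (s≤s (s≤s (s≤s (s≤s z≤n))))))
      where
      ρ : Fin 4 → Fin n
      ρ = p ∷ q ∷ x ∷ y ∷ []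
      ρ≢c : ∀ i → ρ i ≢ c
      ρ≢c = λ { 0F → p≢c ; 1F → q≢c ; 2F → x≢c ; 3F → y≢c }

    -- Without an edge off c the rows of v and c alone would span, so four rows could not be
    -- independent.
    rank4⇒edge : HasSkewRank G 4 → ∃[ p ] ∃[ q ] (p ≢ c × q ≢ c × Adj G p q)
    rank4⇒edge ((ρ , independent) , _)
      with any? (λ p → any? λ q → ¬? (p ≟ᶠ c) ×-dec ¬? (q ≟ᶠ c) ×-dec ¬? (s p q ≟ 0ℚ))
    ... | yes (p , q , p≢c , q≢c , s≢0) = p , q , p≢c , q≢c , ≢0⇒adj G s≢0
    ... | no none = contradiction
      (pendant-span [] (λ _ ()) (λ {x} {j} x≢c j≢c → decidable-stable (s x j ≟ 0ℚ) λ s≢0 →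
         none (x , j , x≢c , j≢c , s≢0)) 4 ρ independent)
      (ℕ.<⇒≱ (s≤s (s≤s (s≤s z≤n))))

    -- The rows of v, c, p, q form a basis: the Pfaffians through the edge p q expand every other
    -- row, off column c, in the rows of p and q.
    pfaffian≡0⇒rank4 : ∀ {p q} → p ≢ c → q ≢ c → Adj G p q →
      (∀ {x y} → x ≢ c → y ≢ c → pfaffian s p q x y ≡ 0ℚ) → HasSkewRank G 4
    pfaffian≡0⇒rank4 {p} {q} p≢c q≢c p–q pf≡0 =
      (v ∷ c ∷ ρ , pendant-independent ρ (λ { 0F → p≢c ; 1F → q≢c }) independent) ,
      pendant-span ρ coordinates span
      where
      open ≡-Reasoning
      ρ : Fin 2 → Fin n
      ρ = p ∷ q ∷ []
      independent : (a : Fin 2 → ℚ) → (∀ j → j ≢ c → sum (λ i → a i * s (ρ i) j) ≡ 0ℚ) →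
                    ∀ i → a i ≡ 0ℚ
      independent a relation 0F = integral-domain (adj⇒≢0 G p–q) (begin
        s p q * a 0F
          ≡⟨ solve 3 (λ x a b → x :* a := a :* x :+ (b :* con 0ℚ :+ con 0ℚ)) refl (s p q) (a 0F) (a 1F) ⟩
        a 0F * s p q + (a 1F * 0ℚ + 0ℚ)
          ≡⟨ cong (λ u → a 0F * s p q + (a 1F * u + 0ℚ)) (skew-diag G q) ⟨
        a 0F * s p q + (a 1F * s q q + 0ℚ)  ≡⟨ relation q q≢c ⟩
        0ℚ                                  ∎)
      independent a relation 1F = integral-domain (adj⇒≢0 G (swap p–q)) (begin
        s q p * a 1F
          ≡⟨ solve 3 (λ x a b → x :* b := a :* con 0ℚ :+ (b :* x :+ con 0ℚ)) refl (s q p) (a 0F) (a 1F) ⟩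
        a 0F * 0ℚ + (a 1F * s q p + 0ℚ)
          ≡⟨ cong (λ u → a 0F * u + (a 1F * s q p + 0ℚ)) (skew-diag G p) ⟨
        a 0F * s p p + (a 1F * s q p + 0ℚ)  ≡⟨ relation p p≢c ⟩
        0ℚ                                  ∎)
      coordinates : Fin n → Fin 2 → ℚ
      -- Solution of the Pfaffian equation for `s x j`, with `s p q` again serving as its own
      -- inverse.
      coordinates x = - s p q * s q x ∷ s p q * s p x ∷ []
      span : ∀ {x j} → x ≢ c → j ≢ c → s x j ≡ sum (λ i → coordinates x i * s (ρ i) j)
      span {x} {j} x≢c j≢c = begin
        s x j                    ≡⟨ ℚ.*-identityˡ (s x j) ⟨
        1ℚ * s x j               ≡⟨ cong (_* s x j) (skew-square G p–q) ⟨
        s p q * s p q * s x j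
          ≡⟨ solve 6 (λ a b c d e f → a :* a :* f :=
               a :* (a :* f :- b :* e :+ c :* d) :+ (:- a :* d :* c :+ (a :* b :* e :+ con 0ℚ)))
               refl (s p q) (s p x) (s p j) (s q x) (s q j) (s x j) ⟩
        s p q * pfaffian s p q x j + (- s p q * s q x * s p j + (s p q * s p x * s q j + 0ℚ))
          ≡⟨ cong (λ u → s p q * u + (- s p q * s q x * s p j + (s p q * s p x * s q j + 0ℚ))) (pf≡0 x≢c j≢c) ⟩
        s p q * 0ℚ + (- s p q * s q x * s p j + (s p q * s p x * s q j + 0ℚ))
          ≡⟨ cong (_+ (- s p q * s q x * s p j + (s p q * s p x * s q j + 0ℚ))) (ℚ.*-zeroʳ (s p q)) ⟩
        0ℚ + (- s p q * s q x * s p j + (s p q * s p x * s q j + 0ℚ))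
          ≡⟨ ℚ.+-identityˡ _ ⟩
        - s p q * s q x * s p j + (s p q * s p x * s q j + 0ℚ) ∎

  -- Evenly-oriented complete multipartite graphs

  module _ {V : Set} (K : OrientedGraph V) (_≟ⱽ_ : DecidableEquality V)
           {k} (part : V → Fin k) (complete : ∀ x y → Adj K x y ⇔ part x ≢ part y)
           (even : Every4CycleEvenlyOriented K) where
    private
      s : V → V → ℚ
      s = skewAdjacency K

      same-part : ∀ {x y} → part x ≡ part y → s x y ≡ 0ℚ
      same-part eq = ¬adj⇒≡0 K λ xy → Equivalence.to (complete _ _) xy eq

      adj : ∀ {x y} → part x ≢ part y → Adj K x y
      adj = Equivalence.from (complete _ _)

    -- If q or y lies in the common part of p and x, each of the three products has a zero factor.
    -- If p = x or q = y, antisymmetry cancels the terms. Otherwise p, q, x, y is a 4-cycle whose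
    -- diagonal p x is absent, and its sign decides.
    even⇒pfaffian≡0₁₃ : ∀ {p q x y} → part p ≡ part x → pfaffian s p q x y ≡ 0ℚ
    even⇒pfaffian≡0₁₃ {p} {q} {x} {y} p∼x
      with part q ≟ᶠ part p | part y ≟ᶠ part p | p ≟ⱽ x | q ≟ⱽ y
    ... | yes q∼p | _ | _ | _ =
      zeros (s p y) (same-part (sym q∼p)) (same-part p∼x) (same-part (trans q∼p p∼x))
      where
      zeros : ∀ u {a b c d e} → a ≡ 0ℚ → c ≡ 0ℚ → e ≡ 0ℚ → a * b - c * d + u * e ≡ 0ℚ
      zeros u {b = b} {d = d} refl refl refl =
        solve 3 (λ u b d → con 0ℚ :* b :- con 0ℚ :* d :+ u :* con 0ℚ := con 0ℚ) refl u b d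
    ... | no _ | yes y∼p | _ | _ =
      zeros (s p q) (same-part (trans (sym p∼x) (sym y∼p))) (same-part p∼x) (same-part (sym y∼p))
      where
      zeros : ∀ u {b c d e f} → b ≡ 0ℚ → c ≡ 0ℚ → e ≡ 0ℚ → u * b - c * d + e * f ≡ 0ℚ
      zeros u {d = d} {f = f} refl refl refl =
        solve 3 (λ u d f → u :* con 0ℚ :- con 0ℚ :* d :+ con 0ℚ :* f := con 0ℚ) refl u d f
    ... | no _ | no _ | yes refl | _ = begin
      s p q * s p y - s p p * s q y + s p y * s q p
        ≡⟨ cong₂ (λ u w → s p q * s p y - u * s q y + s p y * w) (skew-diag K p) (skew-antisym K p q) ⟩
      s p q * s p y - 0ℚ * s q y + s p y * - s p q
        ≡⟨ solve 3 (λ a b c → a :* b :- con 0ℚ :* c :+ b :* (:- a) := con 0ℚ) refl (s p q) (s p y) (s q y) ⟩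
      0ℚ ∎
      where open ≡-Reasoning
    ... | no _ | no _ | no _ | yes refl = begin
      s p q * s x q - s p x * s q q + s p q * s q x
        ≡⟨ cong₂ (λ u w → s p q * s x q - s p x * u + s p q * w) (skew-diag K q) (skew-antisym K x q) ⟩
      s p q * s x q - s p x * 0ℚ + s p q * - s x q
        ≡⟨ solve 3 (λ a b c → a :* b :- c :* con 0ℚ :+ a :* (:- b) := con 0ℚ) refl (s p q) (s x q) (s p x) ⟩
      0ℚ ∎
      where open ≡-Reasoning
    ... | no q≁p | no y≁p | no p≢x | no q≢y = begin
      s p q * s x y - s p x * s q y + s p y * s q x
        ≡⟨ cong₂ (λ u w → s p q * s x y - u * s q y + w * s q x) (same-part p∼x) (skew-antisym K y p) ⟩
      s p q * s x y - 0ℚ * s q y + - s y p * s q x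
        ≡⟨ solve 5 (λ a c e d b → a :* c :- con 0ℚ :* e :+ (:- d) :* b := a :* c :+ (:- d) :* b) refl
             (s p q) (s x y) (s q y) (s y p) (s q x) ⟩
      s p q * s x y + - s y p * s q x
        ≡⟨ signs (skew-sign K p q) (skew-sign K q x) (skew-sign K x y) (skew-sign K y p)
             (ℚ.positive⁻¹ _ {{even u record { length≥3 = s≤s (s≤s (s≤s z≤n)) ; distinct = distinct _ _ ; edges = edges }}}) ⟩
      0ℚ ∎
      where
      open ≡-Reasoning
      u : Fin 4 → V
      u = p ∷ q ∷ x ∷ y ∷ []
      p–q : Adj K p q
      p–q = adj (q≁p ∘ sym)
      q–x : Adj K q x
      q–x = adj λ q∼x → q≁p (trans q∼x (sym p∼x))
      x–y : Adj K x y
      x–y = adj λ x∼y → y≁p (trans (sym x∼y) (sym p∼x))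
      y–p : Adj K y p
      y–p = adj y≁p
      edges : ∀ i → Adj K (u i) (u (next K i))
      edges = λ { 0F → p–q ; 1F → q–x ; 2F → x–y ; 3F → y–p }
      adj⇒≢ : ∀ {a b} → Adj K a b → a ≢ b
      adj⇒≢ ab refl = adj-irrefl K ab
      distinct : ∀ i j → u i ≡ u j → i ≡ j
      distinct 0F 0F _ = refl
      distinct 1F 1F _ = refl
      distinct 2F 2F _ = refl
      distinct 3F 3F _ = refl
      distinct 0F 1F e = contradiction e (adj⇒≢ p–q)
      distinct 1F 0F e = contradiction (sym e) (adj⇒≢ p–q)
      distinct 1F 2F e = contradiction e (adj⇒≢ q–x)
      distinct 2F 1F e = contradiction (sym e) (adj⇒≢ q–x)
      distinct 2F 3F e = contradiction e (adj⇒≢ x–y)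
      distinct 3F 2F e = contradiction (sym e) (adj⇒≢ x–y)
      distinct 3F 0F e = contradiction e (adj⇒≢ y–p)
      distinct 0F 3F e = contradiction (sym e) (adj⇒≢ y–p)
      distinct 0F 2F e = contradiction e p≢x
      distinct 2F 0F e = contradiction (sym e) p≢x
      distinct 1F 3F e = contradiction e q≢y
      distinct 3F 1F e = contradiction (sym e) q≢y
      signs : ∀ {a b c d} → IsSign a → IsSign b → IsSign c → IsSign d →
        0ℚ <ℚ a * (b * (c * (d * 1ℚ))) → a * c + - d * b ≡ 0ℚ
      signs (a , refl) (b , refl) (c , refl) (d , refl) = cycle-sign⁻¹ a b c d

    -- Transpositions carry each coincidence to the first and third places. When p and q lie in
    -- different parts and there are at most three parts, one of the five listed coincidences
    -- occurs.
    even⇒pfaffian≡0 : ∀ {p q x y} →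
      part p ≡ part x ⊎ part q ≡ part x ⊎ part p ≡ part y ⊎ part q ≡ part y ⊎ part x ≡ part y →
      pfaffian s p q x y ≡ 0ℚ
    even⇒pfaffian≡0 (inj₁ p∼x) = even⇒pfaffian≡0₁₃ p∼x
    even⇒pfaffian≡0 (inj₂ (inj₁ q∼x)) = pfaffian-swap₁₂ K (even⇒pfaffian≡0₁₃ q∼x)
    even⇒pfaffian≡0 (inj₂ (inj₂ (inj₁ p∼y))) = pfaffian-swap₃₄ K (even⇒pfaffian≡0₁₃ p∼y)
    even⇒pfaffian≡0 (inj₂ (inj₂ (inj₂ (inj₁ q∼y)))) =
      pfaffian-swap₁₂ K (pfaffian-swap₃₄ K (even⇒pfaffian≡0₁₃ q∼y))
    even⇒pfaffian≡0 (inj₂ (inj₂ (inj₂ (inj₂ x∼y)))) =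
      pfaffian-swap₂₃ K (pfaffian-swap₁₂ K (pfaffian-swap₃₄ K (even⇒pfaffian≡0₁₃ x∼y)))

  -- From a star and a multipartite graph to skew-rank four

  -- A leaf of the star serves as pendant vertex, the centre as its neighbour, and vertices of the
  -- parts `i` and `j` as the edge off the centre. The second hypothesis is how "at most three
  -- parts" is used. A Pfaffian involving a leaf vanishes because leaves are isolated once the
  -- centre is removed.
  star-multipartite⇒rank4 : ∀ {k n} {ns : Vec ℕ k} {G : OrientedGraph (Fin n)} {i j : Fin k} → i ≢ j →
    (∀ a b → i ≡ a ⊎ j ≡ a ⊎ i ≡ b ⊎ j ≡ b ⊎ a ≡ b) →
    StarWithMultipartite ns G → HasSkewRank G 4
  star-multipartite⇒rank4 {n = n} {ns} {G} {i} {j} i≢j pigeonhole (S , K , even , G-from) =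
    PendantRank.pfaffian≡0⇒rank4 G leaf–c (leaf-only-c _) (part≢c p) (part≢c q) p–q pf≡0
    where
    m : ℕ
    m = n ∸ sumᵛ ns
    open ObtainedByInserting G-from
    c : Fin n
    c = ⟦ inj₁ (centre m) ⟧
    s : Fin n → Fin n → ℚ
    s = skewAdjacency G

    injective : ∀ {ξ η} → ⟦ ξ ⟧ ≡ ⟦ η ⟧ → ξ ≡ η
    injective {ξ} {η} eq = trans (sym (Inverse.strictlyInverseʳ vertices ξ))
      (trans (cong (Inverse.from vertices) eq) (Inverse.strictlyInverseʳ vertices η))

    leaf–c : Adj G ⟦ inj₁ (1F , fromℕ< (nonempty S 1F)) ⟧ c
    leaf–c = Sum.map (Equivalence.to (arcsˢ _ _)) (Equivalence.to (arcsˢ _ _))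
      (Equivalence.from (complete S (1F , fromℕ< (nonempty S 1F)) (centre m)) λ ())

    leaf-only-c : ∀ l {u} → Adj G ⟦ inj₁ (1F , l) ⟧ u → c ≡ u
    leaf-only-c l {u} l–u = trans (only (Inverse.from vertices u)
        (subst (Adj G _) (sym (Inverse.strictlyInverseˡ vertices u)) l–u))
      (Inverse.strictlyInverseˡ vertices u)
      where
      only : ∀ η → Adj G ⟦ inj₁ (1F , l) ⟧ ⟦ η ⟧ → c ≡ ⟦ η ⟧
      only (inj₁ (0F , 0F)) _ = refl
      only (inj₁ (1F , l′)) l–l′ = contradiction refl (Equivalence.to (complete S (1F , l) (1F , l′))
        (Sum.map (Equivalence.from (arcsˢ _ _)) (Equivalence.from (arcsˢ _ _)) l–l′))
      only (inj₂ y) l–y with () ← inserted _ _ l–y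

    part≢c : ∀ y → ⟦ inj₂ y ⟧ ≢ c
    part≢c y eq with () ← injective eq

    p q : PartVertex ns
    p = i , fromℕ< (nonempty K i)
    q = j , fromℕ< (nonempty K j)

    p–q : Adj G ⟦ inj₂ p ⟧ ⟦ inj₂ q ⟧
    p–q = Sum.map (Equivalence.to (arcsᵏ _ _)) (Equivalence.to (arcsᵏ _ _))
      (Equivalence.from (complete K p q) i≢j)

    leaf-row : ∀ l {z} → z ≢ c → s ⟦ inj₁ (1F , l) ⟧ z ≡ 0ℚ
    leaf-row l z≢c = ¬adj⇒≡0 G λ l–z → z≢c (sym (leaf-only-c l l–z))

    leaf-column : ∀ l {z} → z ≢ c → s z ⟦ inj₁ (1F , l) ⟧ ≡ 0ℚ
    leaf-column l z≢c = ¬adj⇒≡0 G λ z–l → z≢c (sym (leaf-only-c l (swap z–l)))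

    -- The subscript is the place of the leaf in the Pfaffian: each product then contains an entry
    -- of that leaf off the centre.
    leaf₃ : ∀ a d e {b c f} → b ≡ 0ℚ → c ≡ 0ℚ → f ≡ 0ℚ → a * b - c * d + e * f ≡ 0ℚ
    leaf₃ a d e refl refl refl =
      solve 3 (λ a d e → a :* con 0ℚ :- con 0ℚ :* d :+ e :* con 0ℚ := con 0ℚ) refl a d e

    leaf₄ : ∀ a c f {b d e} → b ≡ 0ℚ → d ≡ 0ℚ → e ≡ 0ℚ → a * b - c * d + e * f ≡ 0ℚ
    leaf₄ a c f refl refl refl =
      solve 3 (λ a c f → a :* con 0ℚ :- c :* con 0ℚ :+ con 0ℚ :* f := con 0ℚ) refl a c f

    pf≡0′ : ∀ ξ η → ⟦ ξ ⟧ ≢ c → ⟦ η ⟧ ≢ c → pfaffian s ⟦ inj₂ p ⟧ ⟦ inj₂ q ⟧ ⟦ ξ ⟧ ⟦ η ⟧ ≡ 0ℚ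
    pf≡0′ (inj₁ (0F , 0F)) _ ξ≢c _ = contradiction refl ξ≢c
    pf≡0′ (inj₁ (1F , l)) η _ η≢c =
      leaf₃ (s ⟦ inj₂ p ⟧ ⟦ inj₂ q ⟧) (s ⟦ inj₂ q ⟧ ⟦ η ⟧) (s ⟦ inj₂ p ⟧ ⟦ η ⟧)
        (leaf-row l η≢c) (leaf-column l (part≢c p)) (leaf-column l (part≢c q))
    pf≡0′ (inj₂ _) (inj₁ (0F , 0F)) _ η≢c = contradiction refl η≢c
    pf≡0′ (inj₂ x) (inj₁ (1F , l)) ξ≢c _ =
      leaf₄ (s ⟦ inj₂ p ⟧ ⟦ inj₂ q ⟧) (s ⟦ inj₂ p ⟧ ⟦ inj₂ x ⟧) (s ⟦ inj₂ q ⟧ ⟦ inj₂ x ⟧)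
        (leaf-column l ξ≢c) (leaf-column l (part≢c q)) (leaf-column l (part≢c p))
    pf≡0′ (inj₂ x) (inj₂ y) _ _ = trans
      (sym (pfaffian-cong (skewAdjacency (graph K)) s (⟦_⟧ ∘ inj₂) (skew-cong (graph K) G (⟦_⟧ ∘ inj₂) arcsᵏ) p q x y))
      (even⇒pfaffian≡0 (graph K) (Product.≡-dec _≟ᶠ_ _≟ᶠ_) proj₁ (complete K) even
        (pigeonhole (proj₁ x) (proj₁ y)))

    pf≡0 : ∀ {x y} → x ≢ c → y ≢ c → pfaffian s ⟦ inj₂ p ⟧ ⟦ inj₂ q ⟧ x y ≡ 0ℚ
    pf≡0 {x} {y} x≢c y≢c =
      subst₂ (λ x y → pfaffian s ⟦ inj₂ p ⟧ ⟦ inj₂ q ⟧ x y ≡ 0ℚ) (onto x) (onto y)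
        (pf≡0′ _ _ (x≢c ∘ trans (sym (onto x))) (y≢c ∘ trans (sym (onto y))))
      where
      onto : ∀ z → ⟦ Inverse.from vertices z ⟧ ≡ z
      onto = Inverse.strictlyInverseˡ vertices

open import Data.Nat using (_+_; _≤_; _<_)
open import Data.Vec using ([]; _∷_)
open import Data.Rational using (0ℚ)

-- Decomposition into a star and a complete multipartite graph

-- Irrelevance of `P` ensures that the pairs count elements and not proofs.
subset-size : ∀ {n} {P : Pred (Fin n) 0ℓ} → Decidable P → (∀ {x} → Irrelevant (P x)) →
  ∃[ m ] Fin m ↔ Σ (Fin n) P
subset-size {zero} _ _ = 0 , mk↔ₛ′ (λ ()) (λ ()) (λ ()) (λ ())
subset-size {suc n} {P} P? irrelevant
  with P? zero | subset-size (P? ∘ suc) irrelevant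
... | no ¬P₀ | m , e = m , mk↔ₛ′ to from to-from (strictlyInverseʳ)
  where
  open Inverse e using (strictlyInverseˡ; strictlyInverseʳ)
  to : Fin m → Σ (Fin (suc n)) P
  to l = let x , Px = Inverse.to e l in suc x , Px
  from : Σ (Fin (suc n)) P → Fin m
  from (zero  , P₀) = contradiction P₀ ¬P₀
  from (suc x , Px) = Inverse.from e (x , Px)
  to-from : ∀ y → to (from y) ≡ y
  to-from (zero  , P₀) = contradiction P₀ ¬P₀
  to-from (suc x , Px) = cong (λ (x , Px) → suc x , Px) (strictlyInverseˡ (x , Px))
... | yes P₀ | m , e = suc m , mk↔ₛ′ to from to-from from-to
  where
  open Inverse e using (strictlyInverseˡ; strictlyInverseʳ)
  to : Fin (suc m) → Σ (Fin (suc n)) P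
  to zero    = zero , P₀
  to (suc l) = let x , Px = Inverse.to e l in suc x , Px
  from : Σ (Fin (suc n)) P → Fin (suc m)
  from (zero  , _)  = zero
  from (suc x , Px) = suc (Inverse.from e (x , Px))
  to-from : ∀ y → to (from y) ≡ y
  to-from (zero  , _)  = cong (zero ,_) (irrelevant _ _)
  to-from (suc x , Px) = cong (λ (x , Px) → suc x , Px) (strictlyInverseˡ (x , Px))
  from-to : ∀ l → from (to l) ≡ l
  from-to zero    = refl
  from-to (suc l) = cong suc (strictlyInverseʳ l)

-- The domain is the disjoint union of the fibres of `f`, each enumerated by its size. Fibres may be
-- empty here; nonempty parts come later from surjectivity.
fibres : ∀ {n k} (f : Fin n → Fin k) →
  Σ[ ns ∈ Vec ℕ k ] Σ[ e ∈ PartVertex ns ↔ Fin n ] (∀ x → f (Inverse.to e x) ≡ proj₁ x)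
fibres {n} {k} f = tabulate size , total ↔-∘ Σ-↔ (↔-id (Fin k)) (λ {i} → fibre i) , λ (i , l) →
    proj₂ (Inverse.to (fibre i) l)
  where
  fibre-size : ∀ i → ∃[ m ] Fin m ↔ Σ (Fin n) λ x → f x ≡ i
  fibre-size i = subset-size (λ x → f x ≟ᶠ i) (Decidable⇒UIP.≡-irrelevant _≟ᶠ_)
  size : Fin k → ℕ
  size = proj₁ ∘ fibre-size
  fibre : ∀ i → Fin (lookup (tabulate size) i) ↔ (Σ[ x ∈ Fin n ] f x ≡ i)
  fibre i = subst (λ m → Fin m ↔ (Σ[ x ∈ Fin n ] f x ≡ i)) (sym (lookup∘tabulate size i)) (proj₂ (fibre-size i))
  total : (Σ[ i ∈ Fin k ] Σ[ x ∈ Fin n ] f x ≡ i) ↔ Fin n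
  total = mk↔ₛ′ (λ (_ , x , _) → x) (λ x → f x , x , refl) (λ _ → refl) λ { (_ , _ , refl) → refl }

PartVertex-∷ : ∀ {k} n (ns : Vec ℕ k) → (Fin n ⊎ PartVertex ns) ↔ PartVertex (n ∷ ns)
PartVertex-∷ n ns = mk↔ₛ′
  (λ { (inj₁ l) → zero , l ; (inj₂ (i , l)) → suc i , l })
  (λ { (zero , l) → inj₁ l ; (suc i , l) → inj₂ (i , l) })
  (λ { (zero , l) → refl ; (suc i , l) → refl })
  (λ { (inj₁ l) → refl ; (inj₂ (i , l)) → refl })

-- Used to count vertices: combined with a labelling by `Fin n` it gives `n` as the sum of the part
-- sizes.
Fin-sum↔PartVertex : ∀ {k} (ns : Vec ℕ k) → Fin (sumᵛ ns) ↔ PartVertex ns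
Fin-sum↔PartVertex []       = mk↔ₛ′ (λ ()) (λ ()) (λ ()) (λ ())
Fin-sum↔PartVertex (n ∷ ns) = PartVertex-∷ n ns ↔-∘ ((↔-id (Fin n) ⊎-↔ Fin-sum↔PartVertex ns) ↔-∘ +↔⊎)

contractible⇒≡1 : ∀ {m} (i : Fin m) → (∀ j → j ≡ i) → m ≡ 1
contractible⇒≡1 {1}           _ _      = refl
contractible⇒≡1 {suc (suc m)} i all≡i with () ← trans (all≡i 0F) (sym (all≡i 1F))

-- For injective `φ` this is the induced subgraph. Arcs agree definitionally, so the arc
-- correspondences of the decomposition are identities.
pullback : ∀ {U V : Set} → OrientedGraph V → (U → V) → OrientedGraph U
pullback G φ = record
  { _⟶_  = λ x y → φ x ⟶ φ y
  ; _⟶?_ = λ x y → φ x ⟶? φ y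
  ; asym = asym
  }
  where open OrientedGraph G

Fin⇒0< : ∀ {m} → Fin m → 0 < m
Fin⇒0< {suc _} _ = s≤s z≤n

star-multipartite-vertices : ∀ {k} L (ns : Vec ℕ k) →
  (PartVertex (1 ∷ L ∷ []) ⊎ PartVertex ns) ↔ PartVertex (1 ∷ L ∷ ns)
star-multipartite-vertices L ns = mk↔ₛ′
  (λ { (inj₁ (0F , l)) → 0F , l ; (inj₁ (1F , l)) → 1F , l ; (inj₂ (i , l)) → suc (suc i) , l })
  (λ { (0F , l) → inj₁ (0F , l) ; (1F , l) → inj₁ (1F , l) ; (suc (suc i) , l) → inj₂ (i , l) })
  (λ { (0F , l) → refl ; (1F , l) → refl ; (suc (suc i) , l) → refl })
  (λ { (inj₁ (0F , l)) → refl ; (inj₁ (1F , l)) → refl ; (inj₂ (i , l)) → refl })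

fibre-location : ∀ {n k} (f : Fin n → Fin k) ns (e : PartVertex ns ↔ Fin n) →
  (∀ x → f (Inverse.to e x) ≡ proj₁ x) →
  ∀ {x i} → f x ≡ i → Σ[ l ∈ Fin (lookup ns i) ] Inverse.to e (i , l) ≡ x
fibre-location f ns e f∘e {x} {i} fx≡i = located (sym class≡i) (strictlyInverseˡ x)
  where
  open Inverse e
  class≡i : proj₁ (from x) ≡ i
  class≡i = trans (sym (f∘e (from x))) (trans (cong f (strictlyInverseˡ x)) fx≡i)
  located : ∀ {i i′ l} → i ≡ i′ → to (i′ , l) ≡ x → Σ[ l ∈ Fin (lookup ns i) ] to (i , l) ≡ x
  located {l = l} refl eq = l , eq

fibre-injective : ∀ {k} (ns : Vec ℕ k) {A : Set} (e : PartVertex ns ↔ A) {i l l′} →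
  Inverse.to e (i , l) ≡ Inverse.to e (i , l′) → l ≡ l′
fibre-injective ns e eq = Product.,-injectiveʳ-UIP (Decidable⇒UIP.≡-irrelevant _≟ᶠ_)
  (trans (sym (strictlyInverseʳ _)) (trans (cong from eq) (strictlyInverseʳ _)))
  where open Inverse e

-- The classes of f are the centre of the star, its leaves, and the k parts.
module Decomposition {n k} (G : OrientedGraph (Fin n)) (c : Fin n) (f : Fin n → Fin (2 + k))
  (fc≡0 : f c ≡ 0F) (f≡0⇒c : ∀ {x} → f x ≡ 0F → x ≡ c)
  (c–leaf : ∀ {x} → f x ≡ 1F → Adj G c x)
  (adj : ∀ {x y} → x ≢ c → y ≢ c → Adj G x y ⇔ (f x ≢ 1F × f y ≢ 1F × f x ≢ f y))
  (pf≡0 : ∀ {p q x y} → p ≢ c → q ≢ c → x ≢ c → y ≢ c → pfaffian (skewAdjacency G) p q x y ≡ 0ℚ)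
  where

  module _ {L} {ns : Vec ℕ k} (e : PartVertex (1 ∷ L ∷ ns) ↔ Fin n)
    (f∘e : ∀ x → f (Inverse.to e x) ≡ proj₁ x) (N>0 : ∀ i → 0 < lookup (1 ∷ L ∷ ns) i) where

    vertices : (PartVertex (1 ∷ L ∷ []) ⊎ PartVertex ns) ↔ Fin n
    vertices = e ↔-∘ star-multipartite-vertices L ns

    private
      ⟦_⟧ : PartVertex (1 ∷ L ∷ []) ⊎ PartVertex ns → Fin n
      ⟦_⟧ = Inverse.to vertices

      centre≡c : ⟦ inj₁ (0F , 0F) ⟧ ≡ c
      centre≡c = f≡0⇒c (f∘e (0F , 0F))

      leaf≢c : ∀ l → ⟦ inj₁ (1F , l) ⟧ ≢ c
      leaf≢c l eq with () ← trans (sym (f∘e (1F , l))) (trans (cong f eq) fc≡0)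

      part≢c : ∀ y → ⟦ inj₂ y ⟧ ≢ c
      part≢c (i , l) eq with () ← trans (sym (f∘e (suc (suc i) , l))) (trans (cong f eq) fc≡0)

      centre–leaf : ∀ l → Adj G ⟦ inj₁ (0F , 0F) ⟧ ⟦ inj₁ (1F , l) ⟧
      centre–leaf l = subst (λ x → Adj G x _) (sym centre≡c) (c–leaf (f∘e (1F , l)))

      leaf-isolated : ∀ l {y} → y ≢ c → ¬ Adj G ⟦ inj₁ (1F , l) ⟧ y
      leaf-isolated l y≢c l–y = proj₁ (Equivalence.to (adj (leaf≢c l) y≢c) l–y) (f∘e (1F , l))

      star : OrientedStar (suc L)
      star = record
        { graph    = pullback G (⟦_⟧ ∘ inj₁)
        ; nonempty = λ { 0F → s≤s z≤n ; 1F → N>0 1F }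
        ; complete = λ where
            (0F , 0F) (0F , 0F) → mk⇔ (λ cc → contradiction cc (adj-irrefl G)) (contradiction refl)
            (0F , 0F) (1F , l)  → mk⇔ (λ _ ()) (λ _ → centre–leaf l)
            (1F , l)  (0F , 0F) → mk⇔ (λ _ ()) (λ _ → swap (centre–leaf l))
            (1F , l)  (1F , l′) → mk⇔ (λ ll′ → contradiction ll′ (leaf-isolated l (leaf≢c l′))) (contradiction refl)
        }

      class-part : ∀ y → f ⟦ inj₂ y ⟧ ≡ suc (suc (proj₁ y))
      class-part (i , l) = f∘e (suc (suc i) , l)

      part≢leaf : ∀ y → f ⟦ inj₂ y ⟧ ≢ 1F
      part≢leaf y eq with () ← trans (sym (class-part y)) eq

      parts : OrientedCompleteMultipartite ns
      parts = record
        { graph    = pullback G (⟦_⟧ ∘ inj₂)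
        ; nonempty = λ i → N>0 (suc (suc i))
        ; complete = λ x y → mk⇔
            (λ xy i≡j → proj₂ (proj₂ (Equivalence.to (adj (part≢c x) (part≢c y)) xy))
               (trans (class-part x) (trans (cong (λ i → suc (suc i)) i≡j) (sym (class-part y)))))
            (λ i≢j → Equivalence.from (adj (part≢c x) (part≢c y))
               (part≢leaf x , part≢leaf y , λ fx≡fy → i≢j (suc-injective (suc-injective
                 (trans (sym (class-part x)) (trans fx≡fy (class-part y)))))))
        }

    star-with-parts : StarWithMultipartite ns G
    star-with-parts = with-star (begin
        n ∸ sumᵛ ns                    ≡⟨ cong (_∸ sumᵛ ns) (↔⇒≡ (e ↔-∘ Fin-sum↔PartVertex (1 ∷ L ∷ ns))) ⟨
        suc L + sumᵛ ns ∸ sumᵛ ns      ≡⟨ ℕ.m+n∸n≡m (suc L) (sumᵛ ns) ⟩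
        suc L                          ∎)
      where
      open ≡-Reasoning
      -- The order of the star is prescribed as `n ∸ sumᵛ ns`, equal to `suc L` only
      -- propositionally; abstracting it as `m` allows matching on the equation.
      with-star : ∀ {m} → m ≡ suc L →
        Σ[ S ∈ OrientedStar m ] Σ[ K ∈ OrientedCompleteMultipartite ns ]
          Every4CycleEvenlyOriented (graph K) ×
          ObtainedByInserting (graph S) (centre m) (graph K) G
      with-star refl = star , parts ,
        pfaffian≡0⇒even (graph parts) (λ p q x y → trans
          (pfaffian-cong (skewAdjacency (graph parts)) (skewAdjacency G) (⟦_⟧ ∘ inj₂)
            (skew-cong (graph parts) G (⟦_⟧ ∘ inj₂) λ _ _ → ⇔-id _) p q x y)
          (pf≡0 (part≢c p) (part≢c q) (part≢c x) (part≢c y))) ,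
        record
          { vertices = vertices
          ; arcsˢ    = λ _ _ → ⇔-id _
          ; arcsᵏ    = λ _ _ → ⇔-id _
          ; inserted = λ where
              (0F , 0F) _ _   → refl
              (1F , l)  y l–y → contradiction l–y (leaf-isolated l (part≢c y))
          }

  decomposition : (∀ i → ∃[ x ] f x ≡ i) →
    Σ[ ns ∈ Vec ℕ k ] (∀ i → 0 < lookup ns i) × StarWithMultipartite ns G
  decomposition onto with fibres f
  ... | n₀ ∷ L ∷ ns , e , f∘e
    -- The class of c is a singleton; identifying its size with 1 gives the first part the shape of
    -- the star's centre.
    with refl ← contractible⇒≡1 {n₀} (proj₁ (fibre-location f (n₀ ∷ L ∷ ns) e f∘e fc≡0)) (λ l → fibre-injective (n₀ ∷ L ∷ ns) e
           (trans (f≡0⇒c (f∘e (0F , l))) (sym (proj₂ (fibre-location f (n₀ ∷ L ∷ ns) e f∘e fc≡0)))))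
    = ns , (λ i → N>0 (suc (suc i))) , star-with-parts e f∘e N>0
    where
    N>0 : ∀ i → 0 < lookup (1 ∷ L ∷ ns) i
    N>0 i = Fin⇒0< (proj₁ (fibre-location f (1 ∷ L ∷ ns) e f∘e (proj₂ (onto i))))

-- Classification of the graphs of skew-rank four

module Classification {n} (G : OrientedGraph (Fin n)) {v c : Fin n}
  (v–c : Adj G v c) (only-c : ∀ {u} → Adj G v u → c ≡ u)
  (no-isolated : NoIsolatedVertex G) (rank4 : HasSkewRank G 4)
  {p q : Fin n} (p≢c : p ≢ c) (q≢c : q ≢ c) (p–q : Adj G p q) where

  open Pendant G v–c only-c
  open PendantRank G v–c only-c

  -- `0F` is the centre, `1F` the zero vector and hence the leaves; `2F`, `3F`, `4F` hold the
  -- vectors with only the second, only the first, or both coordinates nonzero.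
  f : Fin n → Fin 5
  f x with x ≟ᶠ c
  ... | yes _ = 0F
  ... | no  _ = suc (class (s x p) (s x q))

  f-c : f c ≡ 0F
  f-c with c ≟ᶠ c
  ... | yes _  = refl
  ... | no c≢c = contradiction refl c≢c

  f-off-c : ∀ {x} → x ≢ c → f x ≡ suc (class (s x p) (s x q))
  f-off-c {x} x≢c with x ≟ᶠ c
  ... | yes x≡c = contradiction x≡c x≢c
  ... | no  _   = refl

  f≡0⇒c : ∀ {x} → f x ≡ 0F → x ≡ c
  f≡0⇒c {x} _  with x ≟ᶠ c
  f≡0⇒c _  | yes x≡c = x≡c
  f≡0⇒c () | no _

  adj : ∀ {x y} → x ≢ c → y ≢ c → Adj G x y ⇔ (f x ≢ 1F × f y ≢ 1F × f x ≢ f y)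
  adj {x} {y} x≢c y≢c rewrite f-off-c x≢c | f-off-c y≢c = mk⇔
    (λ x–y → let x≢0 , y≢0 , x≢y = to x–y in
      x≢0 ∘ suc-injective , y≢0 ∘ suc-injective , x≢y ∘ suc-injective)
    (λ (x≢1 , y≢1 , x≢y) → from (x≢1 ∘ cong suc , y≢1 ∘ cong suc , x≢y ∘ cong suc))
    where open Equivalence (pfaffian≡0⇒adj⇔separated G p–q (rank4⇒pfaffian≡0 rank4 p≢c q≢c x≢c y≢c))

  -- Such a vertex has no neighbour off c, so the neighbour granted by `no-isolated` must be c.
  c–leaf : ∀ {x} → f x ≡ 1F → Adj G c x
  c–leaf {x} fx≡1 with no-isolated x
  ... | u , x–u with u ≟ᶠ c
  ...   | yes refl = swap x–u
  ...   | no u≢c = contradiction fx≡1 (proj₁ (Equivalence.to (adj x≢c u≢c) x–u))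
    where
    x≢c : x ≢ c
    x≢c refl with () ← trans (sym f-c) fx≡1

  -- `punchIn 4F` runs through the four classes that are always inhabited, witnessed by c, v, p and
  -- q. Whether `4F` is inhabited separates the tripartite from the bipartite case.
  onto : ∀ i → ∃[ x ] f x ≡ punchIn 4F i
  onto 0F = c , f-c
  onto 1F = v , trans (f-off-c v≢c) (cong suc (class-0-0 (row-v p≢c) (row-v q≢c)))
  onto 2F = p , trans (f-off-c p≢c) (cong suc (class-0-≢0 (skew-diag G p) (adj⇒≢0 G p–q)))
  onto 3F = q , trans (f-off-c q≢c) (cong suc (class-≢0-0 (adj⇒≢0 G (swap p–q)) (skew-diag G q)))

  tripartite : ∃[ r ] f r ≡ 4F →
    Σ[ ns ∈ Vec ℕ 3 ] (∀ i → 0 < lookup ns i) × StarWithMultipartite ns G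
  tripartite r = Decomposition.decomposition G c f f-c f≡0⇒c c–leaf adj (rank4⇒pfaffian≡0 rank4)
    λ { 0F → onto 0F ; 1F → onto 1F ; 2F → onto 2F ; 3F → onto 3F ; 4F → r }

  -- With class `4F` empty, `punchOut` relabels `f` as a map to four classes; `lower` and `raise`
  -- transport class equations between the two labellings.
  bipartite : ¬ (∃[ r ] f r ≡ 4F) →
    Σ[ ns ∈ Vec ℕ 2 ] (∀ i → 0 < lookup ns i) × StarWithMultipartite ns G
  bipartite none = Decomposition.decomposition G c g (raise f-c) (f≡0⇒c ∘ lower) (c–leaf ∘ lower)
    (λ x≢c y≢c → let open Equivalence (adj x≢c y≢c) in mk⇔
      (λ x–y → let fx≢1 , fy≢1 , fx≢fy = to x–y in
        fx≢1 ∘ lower , fy≢1 ∘ lower , λ gx≡gy → fx≢fy (trans (lower gx≡gy) (punchIn-punchOut (4≢f _))))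
      (λ (gx≢1 , gy≢1 , gx≢gy) → from (gx≢1 ∘ raise , gy≢1 ∘ raise ,
        λ fx≡fy → gx≢gy (raise (trans fx≡fy (sym (punchIn-punchOut (4≢f _))))))))
    (rank4⇒pfaffian≡0 rank4)
    (λ i → let x , fx≡i = onto i in x , raise fx≡i)
    where
    4≢f : ∀ x → 4F ≢ f x
    4≢f x 4≡fx = none (x , sym 4≡fx)
    g : Fin n → Fin 4
    g x = punchOut (4≢f x)
    lower : ∀ {x i} → g x ≡ i → f x ≡ punchIn 4F i
    lower {x} gx≡i = trans (sym (punchIn-punchOut (4≢f x))) (cong (punchIn 4F) gx≡i)
    raise : ∀ {x i} → f x ≡ punchIn 4F i → g x ≡ i
    raise {x} {i} fx≡i = punchIn-injective 4F (g x) i (trans (punchIn-punchOut (4≢f x)) fx≡i)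

  bipartite-or-tripartite :
    (∃[ n₁ ] ∃[ n₂ ] (2 ≤ n₁ + n₂ × StarWithMultipartite (n₁ ∷ n₂ ∷ []) G))
    ⊎
    (∃[ n₁ ] ∃[ n₂ ] ∃[ n₃ ] (3 ≤ n₁ + n₂ + n₃ × StarWithMultipartite (n₁ ∷ n₂ ∷ n₃ ∷ []) G))
  bipartite-or-tripartite = by-cases (any? λ r → f r ≟ᶠ 4F)
    where
    by-cases : Dec (∃[ r ] f r ≡ 4F) → _
    by-cases (yes r)   = inj₂ (three-parts (tripartite r))
      where
      three-parts : _ → _
      three-parts (n₁ ∷ n₂ ∷ n₃ ∷ [] , ns>0 , G-from) =
        n₁ , n₂ , n₃ , ℕ.+-mono-≤ (ℕ.+-mono-≤ (ns>0 0F) (ns>0 1F)) (ns>0 2F) , G-from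
    by-cases (no none) = inj₁ (two-parts (bipartite none))
      where
      two-parts : _ → _
      two-parts (n₁ ∷ n₂ ∷ [] , ns>0 , G-from) =
        n₁ , n₂ , ℕ.+-mono-≤ (ns>0 0F) (ns>0 1F) , G-from

theorem3p4 : ∀ {n : ℕ} (G : OrientedGraph (Fin n)) →
    HasPendantVertex G →
    NoIsolatedVertex G →
    HasSkewRank G 4 ⇔
    ((∃[ n₁ ] ∃[ n₂ ] (2 ≤ n₁ + n₂ × StarWithMultipartite (n₁ ∷ n₂ ∷ []) G))
    ⊎
    (∃[ n₁ ] ∃[ n₂ ] ∃[ n₃ ] (3 ≤ n₁ + n₂ + n₃ × StarWithMultipartite (n₁ ∷ n₂ ∷ n₃ ∷ []) G)))
theorem3p4 G (v , c , v–c , only-c) no-isolated = mk⇔ decompose rank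
  where
  decompose : HasSkewRank G 4 → _
  decompose rank4 =
    let _ , _ , p≢c , q≢c , p–q = PendantRank.rank4⇒edge G v–c only-c rank4
    in Classification.bipartite-or-tripartite G v–c only-c no-isolated rank4 p≢c q≢c p–q
  rank : _ → HasSkewRank G 4
  rank (inj₁ (_ , _ , _ , G-from)) = star-multipartite⇒rank4 {k = 2} {i = 0F} {1F} (λ ()) (λ where
    0F _ → inj₁ refl
    1F _ → inj₂ (inj₁ refl)) G-from
  rank (inj₂ (_ , _ , _ , _ , G-from)) = star-multipartite⇒rank4 {k = 3} {i = 0F} {1F} (λ ()) (λ where
    0F _  → inj₁ refl
    1F _  → inj₂ (inj₁ refl)
    2F 0F → inj₂ (inj₂ (inj₁ refl))
    2F 1F → inj₂ (inj₂ (inj₂ (inj₁ refl)))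
    2F 2F → inj₂ (inj₂ (inj₂ (inj₂ refl)))) G-from
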